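{- There exists a family $\{G_i\}_{i\in\mathbb N}$ of connected vertex-coloured graphs with constant colouring, with vertex sets enumerated in $\{0,\dots,|V(G_i)|-1\}$ and $G_0=(\{0\},\emptyset)$, such that for every $i\in\mathbb N$: (1) iterated $\beta$-contraction starting from $G_i$ reaches a single-vertex graph in exactly $i$ iterations; (2) $G_i$ has minimal order (number of vertices) and minimal size (number of edges) among all connected, constantly coloured graphs with enumerated vertices for which iterated $\beta$-contraction takes exactly $i$ iterations; (3) $|V(G_i)|=F_{i+2}$ and $G_{i+1}/\beta=G_i$, where $F_j$ is the $j$-th Fibonacci number, $F_0=0$, $F_1=1$, $F_{j+1}=F_j+F_{j-1}$.
   Context: Graphs are finite, simple and undirected. One step of $\beta$-contraction of a vertex-coloured graph $G=(V,E,\gamma)$ with $V=\{0,\dots,n-1\}$ is defined as follows. Let $N_\gamma(v)=\{u\mid \{u,v\}\in E,\ \gamma(u)=\gamma(v)\}$ (for a constant colouring this is the usual neighbourhood). Put $\hat v=\min(N_\gamma(v)\cup\{v\})$ and let $D=(V,B)$ be the digraph with $B=\{(v,\hat v)\mid v\in V\}$. Disregarding self-loops and orientations, $D$ is a forest; each connected component $T$ of $D$ has root $r_T=\min V_T$, and $R$ denotes the set of all roots. Let $\pi:V\to R$ send $v$ to the root of the component of $D$ containing $v$, let $n'=|R|$, let $V'=\{0,\dots,n'-1\}$, and let $\alpha:R\to V'$ be the unique order-preserving bijection. The contraction mapping is $\beta=\alpha\circ\pi:V\to V'$. The contracted graph $G/\beta=(V',E',\gamma')$ has $E'=\{\{\beta(u),\beta(v)\}\mid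 \{u,v\}\in E,\ \beta(u)\ne\beta(v)\}$ and $\gamma'(\beta(v))=\gamma(v)$ for all $v\in V$. Its vertices are thus again enumerated in $\{0,\dots,n'-1\}$, so the step can be repeated. The number of iterations from $G$ is the least $k$ such that after $k$ successive steps the graph has a single vertex. -}

module Defs where

open import Data.Fin as Fin using (Fin; toℕ; cast)
import Data.Fin.Properties as Fin
open import Data.List using (List; _∷_; length; filter; lookup; allFin; cartesianProduct)
open import Data.List.Membership.Propositional using (_∈_)
open import Data.List.Membership.Propositional.Properties
  using (∈-filter⁺; ∈-filter⁻; ∈-allFin; ∈-lookup)
import Data.List.Extrema as Extrema
import Data.List.Relation.Unary.All as All
import Data.List.Relation.Unary.All.Properties as All
import Data.List.Relation.Unary.Any as Any
import Data.List.Relation.Unary.Any.Properties as Any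
open import Data.List.Relation.Unary.AllPairs using (AllPairs; _∷_)
import Data.List.Relation.Unary.AllPairs.Properties as AllPairs
open import Data.Nat as ℕ using (ℕ; zero; suc; _+_; _≤_; _<_; z≤n; s≤s)
import Data.Nat.Properties as ℕ
open import Data.Nat.GeneralisedArithmetic using (fold; iterate)
open import Data.Product using (∃; ∃₂; _×_; _,_; proj₁; proj₂)
open import Function.Base using (_∘_; id)
open import Function.Bundles using (_⇔_)
open import Level using (0ℓ)
open import Relation.Binary using (Rel; Decidable; DecidableEquality; Symmetric; tri<; tri≈; tri>)
open import Relation.Binary.Construct.Closure.Equivalence as EqClosure using (EqClosure)
open import Relation.Binary.Construct.Closure.ReflexiveTransitive using (Star)
open import Relation.Binary.PropositionalEquality
open import Relation.Nullary using (¬_; yes; no; contradiction; ¬?; _×-dec_)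
import Relation.Nullary.Decidable as Dec
import Relation.Unary as Unary

fib : ℕ → ℕ
fib zero          = 0
fib (suc zero)    = 1
fib (suc (suc j)) = fib (suc j) + fib j

record Graph (C : Set) : Set₁ where
  infix 4 _~_ _~?_
  field
    order    : ℕ
    _~_      : Rel (Fin order) 0ℓ
    _~?_     : Decidable _~_
    ~-sym    : Symmetric _~_
    ~-irrefl : ∀ {v} → ¬ v ~ v
    γ        : Fin order → C

open Graph public using (order)

module _ {C : Set} where

  -- Each edge {u , v} is counted once, as the pair with u < v.
  size : Graph C → ℕ
  size G = length (filter (λ (u , v) → (u Fin.<? v) ×-dec (u ~? v))
                          (cartesianProduct (allFin _) (allFin _)))
    where open Graph G

  Edgeless : Graph C → Set
  Edgeless G = ∀ u v → ¬ u ~ v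
    where open Graph G

  Connected : Graph C → Set
  Connected G = ∀ u v → Star _~_ u v
    where open Graph G

  ConstantlyColoured : Graph C → Set
  ConstantlyColoured G = ∀ u v → γ u ≡ γ v
    where open Graph G

  -- Equality of enumerated coloured graphs (not isomorphism): the only map
  -- involved is the cast between Fin types that preserves the vertex numbers.
  infix 4 _≈_
  record _≈_ (G H : Graph C) : Set where
    private
      module G = Graph G
      module H = Graph H
    field
      order≡ : G.order ≡ H.order
      edges⇔ : ∀ u v → (u G.~ v) ⇔ (cast order≡ u H.~ cast order≡ v)
      γ≡     : ∀ v → G.γ v ≡ H.γ (cast order≡ v)

-- The components of the digraph with arcs (v , f v), for a map f on Fin n with
-- f v ≤ v, disregarding orientation: u and v are in the same one iff u ≃ v.
module Components {n : ℕ} (f : Fin n → Fin n) (f≤ : ∀ v → f v Fin.≤ v) where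

  Arc : Rel (Fin n) 0ℓ
  Arc v w = w ≡ f v

  infix 4 _≃_ _≃?_
  _≃_ : Rel (Fin n) 0ℓ
  _≃_ = EqClosure Arc

  ≃-refl : ∀ {v} → v ≃ v
  ≃-refl = EqClosure.reflexive Arc

  ≃-sym : ∀ {u v} → u ≃ v → v ≃ u
  ≃-sym = EqClosure.symmetric Arc

  ≃-trans : ∀ {u v w} → u ≃ v → v ≃ w → u ≃ w
  ≃-trans = EqClosure.transitive Arc

  -- Deciding _≃_: after n iterations of f every vertex has reached the
  -- fixed point in its component.
  end : Fin n → Fin n
  end v = iterate f v n

  iterate-fixed : ∀ k {v} → f v ≡ v → iterate f v k ≡ v
  iterate-fixed zero    p = refl
  iterate-fixed (suc k) p = trans (cong (λ w → iterate f w k) p) (iterate-fixed k p)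

  iterate-f : ∀ k v → iterate f (f v) k ≡ f (iterate f v k)
  iterate-f zero    v = refl
  iterate-f (suc k) v = iterate-f k (f v)

  iterate-stable : ∀ k v → toℕ v ≤ k → f (iterate f v k) ≡ iterate f v k
  iterate-stable zero v v≤0 =
    Fin.toℕ-injective (trans (ℕ.n≤0⇒n≡0 (ℕ.≤-trans (f≤ v) v≤0)) (sym (ℕ.n≤0⇒n≡0 v≤0)))
  iterate-stable (suc k) v v≤1+k with f v Fin.≟ v
  ... | yes p = trans (cong f e) (trans p (sym e))
    where e = iterate-fixed (suc k) p
  ... | no ¬p = iterate-stable k (f v)
    (ℕ.≤-pred (ℕ.≤-trans (ℕ.≤∧≢⇒< (f≤ v) (¬p ∘ Fin.toℕ-injective)) v≤1+k))

  ≃-iterate : ∀ k v → v ≃ iterate f v k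
  ≃-iterate zero    v = ≃-refl
  ≃-iterate (suc k) v = ≃-trans (EqClosure.return refl) (≃-iterate k (f v))

  ≃⇒end : ∀ {u v} → u ≃ v → end u ≡ end v
  ≃⇒end = EqClosure.gfold isEquivalence end λ { {u} refl →
    sym (trans (iterate-f n u) (iterate-stable n u (ℕ.<⇒≤ (Fin.toℕ<n u)))) }

  _≃?_ : Decidable _≃_
  u ≃? v = Dec.map′
    (λ e → ≃-trans (≃-iterate n u) (subst (_≃ v) (sym e) (≃-sym (≃-iterate n v))))
    ≃⇒end (end u Fin.≟ end v)

module _ {n : ℕ} where

  lookup-mono-< : ∀ {xs : List (Fin n)} → AllPairs Fin._<_ xs →
                  ∀ {a b} → a Fin.< b → lookup xs a Fin.< lookup xs b
  lookup-mono-< {_ ∷ xs} (px ∷ _) {Fin.zero} {Fin.suc b} _ = All.lookup px (∈-lookup {xs = xs} b)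
  lookup-mono-< (_ ∷ ps) {Fin.suc a} {Fin.suc b} (s≤s a<b) = lookup-mono-< ps a<b

  lookup-cancel-< : ∀ {xs : List (Fin n)} → AllPairs Fin._<_ xs →
                    ∀ {a b} → lookup xs a Fin.< lookup xs b → a Fin.< b
  lookup-cancel-< {xs} ps {a} {b} lt with Fin.<-cmp a b
  ... | tri< a<b _ _ = a<b
  ... | tri≈ _ a≡b _ = contradiction lt (Fin.<-irrefl (cong (lookup xs) a≡b))
  ... | tri> _ _ b<a = contradiction lt (Fin.<-asym (lookup-mono-< ps b<a))

  lookup-injective : ∀ {xs : List (Fin n)} → AllPairs Fin._<_ xs →
                     ∀ {a b} → lookup xs a ≡ lookup xs b → a ≡ b
  lookup-injective ps {a} {b} eq with Fin.<-cmp a b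
  ... | tri< a<b _ _ = contradiction (lookup-mono-< ps a<b) (Fin.<-irrefl eq)
  ... | tri≈ _ a≡b _ = a≡b
  ... | tri> _ _ b<a = contradiction (lookup-mono-< ps b<a) (Fin.<-irrefl (sym eq))

module Contraction {C : Set} (_≟_ : DecidableEquality C) where

  module Step (G : Graph C) where
    open Graph G using (_~_; _~?_; ~-sym; γ)
    open Extrema (Fin.≤-totalOrder (order G))

    private
      V = Fin (order G)

    N : V → List V
    N v = filter (λ u → (v ~? u) ×-dec (γ u ≟ γ v)) (allFin _)

    -- min v xs is the least element of xs ∪ {v}.
    hat : V → V
    hat v = min v (N v)

    hat≤ : ∀ v → hat v Fin.≤ v
    hat≤ v = min≤⊤ v (N v)

    open Components hat hat≤ public

    π : V → V
    π v = min v (filter (v ≃?_) (allFin _))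

    Root : V → Set
    Root r = ∃ λ v → π v ≡ r

    root? : Unary.Decidable Root
    root? r = Fin.any? λ v → π v Fin.≟ r

    roots : List V
    roots = filter root? (allFin _)

    n′ : ℕ
    n′ = length roots

    root∈ : ∀ {r} → Root r → r ∈ roots
    root∈ {r} = ∈-filter⁺ root? (∈-allFin r)

    -- As roots is listed in increasing order, the order-preserving bijection
    -- sends a root to its position in the list; see α-mono and α-α⁻¹ below.
    α : ∃ Root → Fin n′
    α (_ , p) = Any.index (root∈ p)

    α⁻¹ : Fin n′ → ∃ Root
    α⁻¹ a = lookup roots a , proj₂ (∈-filter⁻ root? {xs = allFin (order G)} (∈-lookup {xs = roots} a))

    β : V → Fin n′
    β v = α (π v , v , refl)

    infix 4 _~′_
    _~′_ : Rel (Fin n′) 0ℓ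
    a ~′ b = ∃₂ λ u v → u ~ v × β u ≢ β v × β u ≡ a × β v ≡ b

    -- The colour γ (π v) is that of the whole component: see γ′-β.
    γ′ : Fin n′ → C
    γ′ a = γ (proj₁ (α⁻¹ a))

    contract : Graph C
    contract = record
      { order    = n′
      ; _~_      = _~′_
      ; _~?_     = λ a b → Fin.any? λ u → Fin.any? λ v →
                     (u ~? v) ×-dec ¬? (β u Fin.≟ β v) ×-dec (β u Fin.≟ a) ×-dec (β v Fin.≟ b)
      ; ~-sym    = λ (u , v , e , ne , p , q) → v , u , ~-sym e , ne ∘ sym , q , p
      ; ~-irrefl = λ (u , v , e , ne , p , q) → ne (trans p (sym q))
      ; γ        = γ′
      }

    roots-↗ : AllPairs Fin._<_ roots
    roots-↗ = AllPairs.filter⁺ root? (AllPairs.tabulate⁺-< id)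

    α⁻¹-α : ∀ r → proj₁ (α⁻¹ (α r)) ≡ proj₁ r
    α⁻¹-α (_ , p) = sym (Any.lookup-index (root∈ p))

    α-mono : ∀ r s → proj₁ r Fin.< proj₁ s → α r Fin.< α s
    α-mono r s r<s =
      lookup-cancel-< roots-↗ (subst₂ Fin._<_ (sym (α⁻¹-α r)) (sym (α⁻¹-α s)) r<s)

    α-α⁻¹ : ∀ a → α (α⁻¹ a) ≡ a
    α-α⁻¹ a = lookup-injective roots-↗ (α⁻¹-α (α⁻¹ a))

    γ-hat : ∀ v → γ (hat v) ≡ γ v
    γ-hat v = argmin-all id {P = λ u → γ u ≡ γ v} refl
      (All.map proj₂ (All.all-filter (λ u → (v ~? u) ×-dec (γ u ≟ γ v)) (allFin _)))

    π-≃ : ∀ v → v ≃ π v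
    π-≃ v = argmin-all id {P = v ≃_} ≃-refl (All.all-filter (v ≃?_) (allFin _))

    γ′-β : ∀ v → γ′ (β v) ≡ γ v
    γ′-β v = trans (cong γ (α⁻¹-α (π v , v , refl))) (sym (γ-≃ (π-≃ v)))
      where
      γ-≃ : ∀ {u w} → u ≃ w → γ u ≡ γ w
      γ-≃ = EqClosure.gfold isEquivalence γ λ { {u} refl → sym (γ-hat u) }

  infixl 8 _/β
  _/β : Graph C → Graph C
  G /β = Step.contract G

  infixl 8 _/β^_
  _/β^_ : Graph C → ℕ → Graph C
  G /β^ k = fold G _/β k

  Iterations : Graph C → ℕ → Set
  Iterations G k = order (G /β^ k) ≡ 1 × (∀ j → j < k → order (G /β^ j) ≢ 1)

{-# OPTIONS --safe #-}

-- Let G → G′ → G″ be two contraction steps. If a is a root of G′ and p is the least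
-- vertex of its class in G, then any neighbour of p lies in the same class, so the class
-- contains a vertex that is not a root of G. Hence |G″| is at most the number |G| − |G′|
-- of non-roots of G, and this Fibonacci inequality bounds the order from below; the size
-- bound follows as the extremal graphs are trees. In the extremal graph, each root of G′
-- has exactly one extra vertex in its class.

module Submission where

open import Defs
open import Data.Empty using (⊥)
open import Data.Fin as Fin using (Fin; toℕ; cast; _↑ˡ_; _↑ʳ_; splitAt; punchIn; punchOut)
import Data.Fin.Properties as Fin
open import Data.List using (List; []; _∷_; _++_; length; lookup; map; filter; allFin; cartesianProduct)
open import Data.List.Properties using (length-map; length-++; length-tabulate)
open import Data.List.Membership.Propositional using (_∈_)
open import Data.List.Membership.Propositional.Properties
  using (∈-filter⁺; ∈-filter⁻; ∈-allFin; ∈-lookup; ∈-cartesianProduct⁺; ∈-map⁺; ∈-++⁺ˡ; ∈-++⁺ʳ)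
open import Data.List.Relation.Binary.Subset.Propositional using (_⊆_)
import Data.List.Extrema as Extrema
open import Data.List.Relation.Unary.All as All using (All)
import Data.List.Relation.Unary.All.Properties as All
open import Data.List.Relation.Unary.AllPairs using (_∷_)
import Data.List.Relation.Unary.Any as Any
import Data.List.Relation.Unary.Any.Properties as Any
open import Data.List.Relation.Unary.Unique.Propositional using (Unique)
import Data.List.Relation.Unary.Unique.Propositional.Properties as Unique
open import Data.Nat as ℕ using (ℕ; zero; suc; _+_; _≤_; _<_; z≤n; s≤s)
import Data.Nat.Properties as ℕ
open import Data.Nat.GeneralisedArithmetic using (fold; iterate)
open import Data.Product using (Σ-syntax; ∃; ∃₂; _×_; _,_; proj₁; proj₂)
open import Data.Sum using (_⊎_; inj₁; inj₂; [_,_]′; swap)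
open import Function.Base using (_∘_; id)
open import Function.Bundles using (_⇔_; mk⇔; Equivalence)
open import Function.Definitions using (Injective)
open import Relation.Binary using (Rel; Decidable; DecidableEquality; tri<; tri≈; tri>)
open import Relation.Binary.Construct.Closure.ReflexiveTransitive as Star using (Star; ε; _◅_; _◅◅_)
open import Relation.Binary.PropositionalEquality
open import Relation.Nullary using (yes; no; contradiction; _×-dec_; _⊎-dec_)

open Equivalence using (to; from)

-- Strictly monotone maps between finite ordinals.

-- Applied to a map and to its inverse, this forces an order isomorphism to preserve vertex numbers.
mono⇒toℕ≤ : ∀ {m n} (f : Fin m → Fin n) → (∀ {a c} → a Fin.< c → f a Fin.< f c) →
            ∀ a → toℕ a ≤ toℕ (f a)
mono⇒toℕ≤ f mono a = go (toℕ a) a refl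
  where
  go : ∀ k a → toℕ a ≡ k → k ≤ toℕ (f a)
  go zero    a         eq = z≤n
  go (suc k) (Fin.suc a) refl =
    ℕ.≤-<-trans (go k (Fin.inject₁ a) (Fin.toℕ-inject₁ a))
      (mono (s≤s (ℕ.≤-reflexive (Fin.toℕ-inject₁ a))))

mono-cancel-< : ∀ {m n} (f : Fin m → Fin n) → (∀ {a c} → a Fin.< c → f a Fin.< f c) →
                ∀ {a c} → f a Fin.< f c → a Fin.< c
mono-cancel-< f mono {a} {c} fa<fc with Fin.<-cmp a c
... | tri< a<c _ _    = a<c
... | tri≈ _ refl _ = contradiction fa<fc (ℕ.<-irrefl refl)
... | tri> _ _ c<a  = contradiction fa<fc (ℕ.<-asym (mono c<a))

-- Iterated steps and Fibonacci growth.

-- The step s stands for _/β; it is kept abstract because comparing unfolded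
-- iterated contractions during conversion checking is intractable.
module _ {A : Set₁} where

  -- Induction on the number `d` of steps still to come: `o+o` adds the bounds obtained one and two
  -- steps later. `P` is the invariant under which `o+o` holds, later connectedness together with
  -- constant colouring.
  fib≤fold : (o : A → ℕ) (s : A → A) (P : A → Set) → (∀ x → P x → P (s x)) →
             (∀ x → o (s x) ≤ o x) → (∀ x → P x → o x ≢ 1 → o (s x) + o (s (s x)) ≤ o x) →
             ∀ {z i} → P z → o (fold z s i) ≡ 1 → (∀ j → j < i → o (fold z s j) ≢ 1) →
             ∀ d j → j + d ≡ i → fib (2 + d) ≤ o (fold z s j)
  fib≤fold o s P P-s o-s o+o {z} Pz end not-before = go
    where
    P-fold : ∀ k → P (fold z s k)
    P-fold zero    = Pz
    P-fold (suc k) = P-s _ (P-fold k)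

    go : ∀ d j → j + d ≡ _ → fib (2 + d) ≤ o (fold z s j)
    go zero j refl =
      ℕ.≤-reflexive (sym (subst (λ k → o (fold z s k) ≡ 1) (ℕ.+-identityʳ j) end))
    -- One step before the end the order is at least 1 by `o-s` and differs from 1, so it is at
    -- least 2, which is `fib 3`.
    go (suc zero) j refl =
      ℕ.≤∧≢⇒< (ℕ.≤-trans (go zero (suc j) (sym (ℕ.+-suc j 0))) (o-s _))
        (not-before j (ℕ.m<m+n j (s≤s z≤n)) ∘ sym)
    go (suc (suc d)) j refl = ℕ.≤-trans
      (ℕ.+-mono-≤ (go (suc d) (suc j) (sym (ℕ.+-suc j (suc d))))
                  (go d (suc (suc j)) (sym (trans (ℕ.+-suc j (suc d)) (cong suc (ℕ.+-suc j d))))))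
      (o+o _ (P-fold j) (not-before j (ℕ.m<m+n j (s≤s z≤n))))

  -- `R` will be `_≈_`, since contracting a family member gives its predecessor only up to a cast.
  -- By induction `k` steps lead from `g (k + suc j)` to `g (suc j)`; `s-cong` and `g-step` account
  -- for the last, outermost step.
  fold-descends : (R : A → A → Set) → (∀ {x} → R x x) → (∀ {x y z} → R x y → R y z → R x z) →
                  (s : A → A) → (∀ {x y} → R x y → R (s x) (s y)) →
                  (g : ℕ → A) → (∀ i → R (s (g (suc i))) (g i)) →
                  ∀ k j → R (fold (g (k + j)) s k) (g j)
  fold-descends R R-refl R-trans s s-cong g g-step zero    j = R-refl
  fold-descends R R-refl R-trans s s-cong g g-step (suc k) j = R-trans
    (s-cong (subst (λ i → R (fold (g i) s k) (g (suc j))) (ℕ.+-suc k j)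
      (fold-descends R R-refl R-trans s s-cong g g-step k (suc j))))
    (g-step j)

-- Enumerated graphs: equality, number of edges, neighbours.

module _ {C : Set} where

  ≈-trans : ∀ {G H K : Graph C} → G ≈ H → H ≈ K → G ≈ K
  ≈-trans {G} {H} {K} p q = record
    { order≡ = trans p.order≡ q.order≡
    ; edges⇔ = λ u v → mk⇔
        (λ e → subst₂ K._~_ (eq u) (eq v) (to (q.edges⇔ _ _) (to (p.edges⇔ u v) e)))
        (λ e → from (p.edges⇔ u v)
                 (from (q.edges⇔ _ _) (subst₂ K._~_ (sym (eq u)) (sym (eq v)) e)))
    ; γ≡ = λ v → trans (p.γ≡ v) (trans (q.γ≡ _) (cong K.γ (eq v)))
    }
    where
    module K = Graph K
    module p = _≈_ p
    module q = _≈_ q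
    eq = Fin.cast-trans p.order≡ q.order≡

  ≈-refl : ∀ {G : Graph C} → G ≈ G
  ≈-refl {G} = record
    { order≡ = refl
    ; edges⇔ = λ u v → mk⇔
        (subst₂ G._~_ (sym (Fin.cast-is-id refl u)) (sym (Fin.cast-is-id refl v)))
        (subst₂ G._~_ (Fin.cast-is-id refl u) (Fin.cast-is-id refl v))
    ; γ≡ = λ v → cong G.γ (sym (Fin.cast-is-id refl v))
    }
    where module G = Graph G

  -- Identifying the endpoints of the first edge lowers n by at most one.
  connecting⇒≤ : ∀ {n} m (e : Fin m → Fin n × Fin n) →
    (∀ (f : Fin n → ℕ) → (∀ i → f (proj₁ (e i)) ≡ f (proj₂ (e i))) → ∀ u v → f u ≡ f v) →
    n ≤ suc m
  connecting⇒≤ {zero}        _    _ _    = z≤n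
  connecting⇒≤ {suc zero}    zero _ _    = ℕ.≤-refl
  connecting⇒≤ {suc (suc n)} zero _ conn =
    -- Without edges every map qualifies, and `toℕ` separates the vertices 0 and 1.
    contradiction (conn toℕ (λ ()) Fin.zero (Fin.suc Fin.zero)) λ ()
  connecting⇒≤ {suc n} (suc m) e conn with proj₂ (e Fin.zero) Fin.≟ proj₁ (e Fin.zero)
  ... | yes y≡x = ℕ.m≤n⇒m≤1+n (connecting⇒≤ m (e ∘ Fin.suc) λ f p →
                    conn f λ { Fin.zero → cong f (sym y≡x) ; (Fin.suc i) → p i })
  -- Connectedness is phrased through functions because these pull back along `merge`. The section
  -- `punchIn y` of `merge` then returns the conclusion to the smaller vertex set.
  ... | no y≢x = s≤s (connecting⇒≤ m (merge₂ ∘ e ∘ Fin.suc) λ f p u v →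
      trans (cong f (sym (merge-punchIn u)))
        (trans (conn (f ∘ merge)
                  (λ { Fin.zero → cong f (trans merge-x (sym merge-y)) ; (Fin.suc i) → p i })
                 (punchIn y u) (punchIn y v))
          (cong f (merge-punchIn v))))
    where
    x = proj₁ (e Fin.zero)
    y = proj₂ (e Fin.zero)

    merge : Fin (suc n) → Fin n
    merge w with y Fin.≟ w
    ... | yes _  = punchOut y≢x
    ... | no y≢w = punchOut y≢w

    merge₂ : Fin (suc n) × Fin (suc n) → Fin n × Fin n
    merge₂ (u , v) = merge u , merge v

    merge-y : merge y ≡ punchOut y≢x
    merge-y with y Fin.≟ y
    ... | yes _  = refl
    ... | no y≢y = contradiction refl y≢y

    merge-x : merge x ≡ punchOut y≢x
    merge-x with y Fin.≟ x
    ... | yes _ = refl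
    ... | no _  = Fin.punchOut-cong y refl

    merge-punchIn : ∀ u → merge (punchIn y u) ≡ u
    merge-punchIn u with y Fin.≟ punchIn y u
    ... | yes eq = contradiction (sym eq) (Fin.punchInᵢ≢i y u)
    ... | no _   = trans (Fin.punchOut-cong y refl) (Fin.punchOut-punchIn y)

  edges : (G : Graph C) → List (Fin (order G) × Fin (order G))
  edges G = filter (λ (u , v) → (u Fin.<? v) ×-dec (u ~? v))
                   (cartesianProduct (allFin _) (allFin _))
    where open Graph G

  -- A map with equal values at the ends of each listed edge is constant along every path, once each
  -- edge of the path is oriented as in `edges`; this is the hypothesis of `connecting⇒≤`.
  connected⇒order≤1+size : ∀ (G : Graph C) → Connected G → order G ≤ suc (size G)
  connected⇒order≤1+size G conn = connecting⇒≤ _ (lookup (edges G)) λ f p u v →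
    Star.fold (λ u v → f u ≡ f v) (λ e → trans (step f p e)) refl (conn u v)
    where
    open Graph G hiding (order)

    oriented : ∀ {u v} → u Fin.< v → u ~ v → (u , v) ∈ edges G
    oriented u<v e = ∈-filter⁺ (λ (u , v) → (u Fin.<? v) ×-dec (u ~? v))
      (∈-cartesianProduct⁺ (∈-allFin _) (∈-allFin _)) (u<v , e)

    module _ (f : Fin (order G) → ℕ)
             (p : ∀ i → f (proj₁ (lookup (edges G) i)) ≡ f (proj₂ (lookup (edges G) i))) where

      listed : ∀ {u v} → (u , v) ∈ edges G → f u ≡ f v
      listed e∈ = subst (λ (u , v) → f u ≡ f v) (sym (Any.lookup-index e∈)) (p (Any.index e∈))

      step : ∀ {u v} → u ~ v → f u ≡ f v
      step {u} {v} e with Fin.<-cmp u v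
      ... | tri< u<v _ _  = listed (oriented u<v e)
      ... | tri≈ _ refl _ = refl
      ... | tri> _ _ v<u  = sym (listed (oriented v<u (~-sym e)))

  -- A path from `p` to any other vertex starts with an edge at `p`.
  connected⇒neighbour : ∀ (G : Graph C) → Connected G → order G ≢ 1 →
                        ∀ p → ∃ λ u → Graph._~_ G p u
  connected⇒neighbour G conn ≢1 p = first (conn p (proj₁ (other p ≢1))) (proj₂ (other p ≢1))
    where
    other : ∀ {n} (p : Fin n) → n ≢ 1 → ∃ λ q → p ≢ q
    other {suc zero}    p           ≢1 = contradiction refl ≢1
    other {suc (suc n)} Fin.zero    _  = Fin.suc Fin.zero , λ ()
    other {suc (suc n)} (Fin.suc p) _  = Fin.zero , λ ()

    first : ∀ {u v} → Star (Graph._~_ G) u v → u ≢ v → ∃ λ w → Graph._~_ G u w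
    first ε       u≢u = contradiction refl u≢u
    first (e ◅ _) _   = _ , e

-- Lists without repetitions.

module _ {A : Set} where

  unique⇒lookup-injective : ∀ {xs : List A} → Unique xs → Injective _≡_ _≡_ (lookup xs)
  unique⇒lookup-injective (x∉ ∷ u) {Fin.zero}  {Fin.zero}  eq = refl
  unique⇒lookup-injective {_ ∷ xs} (x∉ ∷ u) {Fin.zero}  {Fin.suc j} eq =
    contradiction eq (All.lookup x∉ (∈-lookup {xs = xs} j))
  unique⇒lookup-injective {_ ∷ xs} (x∉ ∷ u) {Fin.suc i} {Fin.zero}  eq =
    contradiction (sym eq) (All.lookup x∉ (∈-lookup {xs = xs} i))
  unique⇒lookup-injective (x∉ ∷ u) {Fin.suc i} {Fin.suc j} eq =
    cong Fin.suc (unique⇒lookup-injective u eq)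

  unique⊆⇒length≤ : ∀ {xs ys : List A} → Unique xs → xs ⊆ ys → length xs ≤ length ys
  unique⊆⇒length≤ {xs} {ys} u xs⊆ys = Fin.injective⇒≤ {f = λ i → Any.index (mem i)} λ {i} {j} eq →
    unique⇒lookup-injective u
      (trans (Any.lookup-index (mem i)) (trans (cong (lookup ys) eq) (sym (Any.lookup-index (mem j)))))
    where
    mem : ∀ i → lookup xs i ∈ ys
    mem i = xs⊆ys (∈-lookup {xs = xs} i)

-- The maps `hat`, `end` and `π` of a contraction step.

module _ {C : Set} (_≟_ : DecidableEquality C) where

  open Contraction _≟_

  module _ (G : Graph C) where
    open Graph G hiding (order)
    open Step G
    open Extrema (Fin.≤-totalOrder (order G))

    private
      sameColourNeighbour? = λ v u → (v ~? u) ×-dec (γ u ≟ γ v)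

    hat≤neighbour : ∀ {v u} → v ~ u → γ u ≡ γ v → hat v Fin.≤ u
    hat≤neighbour {v} {u} e c =
      All.lookup (min≤xs v (N v)) (∈-filter⁺ (sameColourNeighbour? v) (∈-allFin u) (e , c))

    -- A minimum is the only lower bound that is itself a member. All later computations of `hat` go
    -- through this instead of the filtered list.
    hat-unique : ∀ {v w} → w Fin.≤ v → w ≡ v ⊎ (v ~ w × γ w ≡ γ v) →
                 (∀ {u} → v ~ u → γ u ≡ γ v → w Fin.≤ u) → hat v ≡ w
    hat-unique {v} {w} w≤v sel w≤N = Fin.≤-antisym (hat≤w sel)
      (v≤min⁺ w≤v (All.map (λ (e , c) → w≤N e c) (All.all-filter (sameColourNeighbour? v) (allFin _))))
      where
      hat≤w : w ≡ v ⊎ (v ~ w × γ w ≡ γ v) → hat v Fin.≤ w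
      hat≤w (inj₁ refl)    = min≤⊤ v (N v)
      hat≤w (inj₂ (e , c)) = hat≤neighbour e c

    hat-sel : ∀ v → hat v ≡ v ⊎ (v ~ hat v × γ (hat v) ≡ γ v)
    hat-sel v with argmin-sel id v (N v)
    ... | inj₁ eq = inj₁ eq
    ... | inj₂ ∈N = inj₂ (proj₂ (∈-filter⁻ (sameColourNeighbour? v) {xs = allFin _} ∈N))

    end-fixed : ∀ v → hat (end v) ≡ end v
    end-fixed v = iterate-stable _ v (ℕ.<⇒≤ (Fin.toℕ<n v))

    end≤ : ∀ v → end v Fin.≤ v
    end≤ v = go (order G) v
      where
      go : ∀ k v → iterate hat v k Fin.≤ v
      go zero    v = ℕ.≤-refl
      go (suc k) v = ℕ.≤-trans (go k (hat v)) (hat≤ v)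

    end-hat : ∀ v → end (hat v) ≡ end v
    end-hat v = trans (iterate-f (order G) v) (end-fixed v)

    -- The vertex `end v` lies in the component of `v`, so `π v` is at most `end v`. Conversely
    -- `end` is constant on components and never exceeds its argument, here `π v`.
    π≡end : ∀ v → π v ≡ end v
    π≡end v = Fin.≤-antisym
      (All.lookup (min≤xs v (filter (v ≃?_) (allFin _)))
        (∈-filter⁺ (v ≃?_) (∈-allFin (end v)) (≃-iterate (order G) v)))
      (subst (Fin._≤ π v) (sym (≃⇒end (π-≃ v))) (end≤ (π v)))

  -- The relation `_↠_` and its uniqueness.

  -- A description of G /β up to _≈_ that avoids components and root lists:
  -- every vertex is connected in the digraph to the unique fixed point of hat
  -- that is reached by iterating hat, so the root of v is fromᵥ (toᵥ v).
  infix 4 _↠_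
  record _↠_ (G K : Graph C) : Set where
    private
      module G = Graph G
      module K = Graph K
    open Step G using (hat; end)
    field
      toᵥ       : Fin G.order → Fin K.order
      fromᵥ     : Fin K.order → Fin G.order
      from-mono : ∀ {a c} → a Fin.< c → fromᵥ a Fin.< fromᵥ c
      to-from   : ∀ a → toᵥ (fromᵥ a) ≡ a
      to-hat    : ∀ v → toᵥ (hat v) ≡ toᵥ v
      fixed     : ∀ v → hat v ≡ v → fromᵥ (toᵥ v) ≡ v
      edges⇔    : ∀ a c → (a K.~ c) ⇔
                  (∃₂ λ u v → u G.~ v × toᵥ u ≢ toᵥ v × toᵥ u ≡ a × toᵥ v ≡ c)
      γ-to      : ∀ v → K.γ (toᵥ v) ≡ G.γ v

    -- By `to-hat`, `toᵥ` does not change along iterates of `hat`; at `end v`, a fixed point,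
    -- `fixed` applies.
    from-to : ∀ v → fromᵥ (toᵥ v) ≡ end v
    from-to v = trans (cong fromᵥ (sym (to-end G.order v))) (fixed (end v) (end-fixed G v))
      where
      to-end : ∀ k v → toᵥ (iterate hat v k) ≡ toᵥ v
      to-end zero    v = refl
      to-end (suc k) v = trans (to-end k (hat v)) (to-hat v)

    from-injective : Injective _≡_ _≡_ fromᵥ
    from-injective eq = trans (sym (to-from _)) (trans (cong toᵥ eq) (to-from _))

    order≤ : K.order ≤ G.order
    order≤ = Fin.injective⇒≤ from-injective

    from-to≤ : ∀ v → fromᵥ (toᵥ v) Fin.≤ v
    from-to≤ v = subst (Fin._≤ v) (sym (from-to v)) (end≤ G v)

    from-fixed : ∀ a → hat (fromᵥ a) ≡ fromᵥ a
    from-fixed a = subst (λ w → hat w ≡ w) (trans (sym (from-to _)) (cong fromᵥ (to-from a)))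
                     (end-fixed G (fromᵥ a))

  module _ {G K L : Graph C} (p : G ↠ K) (q : G ↠ L) where
    private
      module K = Graph K
      module L = Graph L
      module p = _↠_ p
      module q = _↠_ q

    relabel : Fin K.order → Fin L.order
    relabel a = q.toᵥ (p.fromᵥ a)

    from-relabel : ∀ a → q.fromᵥ (relabel a) ≡ p.fromᵥ a
    from-relabel a = trans (q.from-to _) (trans (sym (p.from-to _)) (cong p.fromᵥ (p.to-from a)))

    relabel-to : ∀ v → relabel (p.toᵥ v) ≡ q.toᵥ v
    relabel-to v =
      trans (cong q.toᵥ (trans (p.from-to v) (sym (q.from-to v)))) (q.to-from (q.toᵥ v))

    relabel-injective : Injective _≡_ _≡_ relabel
    relabel-injective {a} {c} eq = p.from-injective
      (trans (sym (from-relabel a)) (trans (cong q.fromᵥ eq) (from-relabel c)))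

    relabel-mono : ∀ {a c} → a Fin.< c → relabel a Fin.< relabel c
    relabel-mono a<c = mono-cancel-< q.fromᵥ q.from-mono
      (subst₂ Fin._<_ (sym (from-relabel _)) (sym (from-relabel _)) (p.from-mono a<c))

    relabel-edge : ∀ {a c} → a K.~ c → relabel a L.~ relabel c
    relabel-edge {a} {c} e with to (p.edges⇔ a c) e
    ... | u , v , uv , ne , refl , refl = from (q.edges⇔ _ _)
      (u , v , uv
      , (λ eq → ne (relabel-injective (trans (relabel-to u) (trans eq (sym (relabel-to v))))))
      , sym (relabel-to u) , sym (relabel-to v))

  relabel-inverse : ∀ {G K L : Graph C} (p : G ↠ K) (q : G ↠ L) a →
                    relabel q p (relabel p q a) ≡ a
  relabel-inverse p q a = p.from-injective
    (trans (from-relabel q p _) (from-relabel p q a))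
    where module p = _↠_ p

  -- `K` and `L` both number the same roots of `G` in increasing order. Matching vertices through
  -- their roots gives mutually inverse, strictly monotone maps, which therefore preserve numbers
  -- and coincide with the casts.
  ↠-functional : ∀ {G K L : Graph C} → G ↠ K → G ↠ L → K ≈ L
  ↠-functional {G} {K} {L} p q = record
    { order≡ = order≡
    ; edges⇔ = λ u v → mk⇔
        (λ e → subst₂ L._~_ (relabel≡cast u) (relabel≡cast v) (relabel-edge p q e))
        (λ e → subst₂ K._~_ (relabel-inverse p q u) (relabel-inverse p q v)
                 (relabel-edge q p
                   (subst₂ L._~_ (sym (relabel≡cast u)) (sym (relabel≡cast v)) e)))
    ; γ≡ = λ a → trans (cong K.γ (sym (p.to-from a))) (trans (p.γ-to _)
                   (trans (sym (q.γ-to _)) (cong L.γ (relabel≡cast a))))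
    }
    where
    module K = Graph K
    module L = Graph L
    module p = _↠_ p
    module q = _↠_ q

    order≡ : K.order ≡ L.order
    order≡ = ℕ.≤-antisym (Fin.injective⇒≤ (relabel-injective p q))
                         (Fin.injective⇒≤ (relabel-injective q p))

    relabel≡cast : ∀ a → relabel p q a ≡ cast order≡ a
    relabel≡cast a = Fin.toℕ-injective (trans (ℕ.≤-antisym
      (subst (λ c → toℕ (relabel p q a) ≤ toℕ c) (relabel-inverse p q a)
        (mono⇒toℕ≤ (relabel q p) (relabel-mono q p) (relabel p q a)))
      (mono⇒toℕ≤ (relabel p q) (relabel-mono p q) a)) (sym (Fin.toℕ-cast order≡ a)))

  -- The list of roots is strictly increasing, so equations between vertices of `G /β` can be
  -- checked on roots, where `π` is known to be `end`.
  ↠-contract : ∀ (G : Graph C) → G ↠ G /β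
  ↠-contract G = record
    { toᵥ       = β
    ; fromᵥ     = proj₁ ∘ α⁻¹
    ; from-mono = lookup-mono-< roots-↗
    ; to-from   = λ a → lookup-injective roots-↗
                    (trans (from-β _) (π-root (proj₂ (α⁻¹ a))))
    ; to-hat    = λ v → lookup-injective roots-↗
                    (trans (from-β _) (trans (π-hat v) (sym (from-β v))))
    ; fixed     = λ v p → trans (from-β v) (trans (π≡end G v) (iterate-fixed (order G) p))
    ; edges⇔    = λ a c → mk⇔ id id
    ; γ-to      = γ′-β
    }
    where
    open Step G

    from-β : ∀ v → proj₁ (α⁻¹ (β v)) ≡ π v
    from-β v = α⁻¹-α (π v , v , refl)

    π-hat : ∀ v → π (hat v) ≡ π v
    π-hat v = trans (π≡end G (hat v)) (trans (end-hat G v) (sym (π≡end G v)))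

    π-root : ∀ {r} → Root r → π r ≡ r
    π-root (v , refl) = trans (π≡end G (π v)) (trans (sym (≃⇒end (π-≃ v))) (sym (π≡end G v)))

  ≈-↠-trans : ∀ {G H K : Graph C} → G ≈ H → H ↠ K → G ↠ K
  ≈-↠-trans {G} {H} {K} p q = record
    { toᵥ       = q.toᵥ ∘ ι
    ; fromᵥ     = ι⁻¹ ∘ q.fromᵥ
    ; from-mono = λ {a} {c} a<c → subst₂ _<_ (sym (Fin.toℕ-cast _ (q.fromᵥ a)))
                    (sym (Fin.toℕ-cast _ (q.fromᵥ c))) (q.from-mono a<c)
    ; to-from   = λ a → trans (cong q.toᵥ (ι-ι⁻¹ _)) (q.to-from a)
    ; to-hat    = λ v → trans (cong q.toᵥ (ι-hat v)) (q.to-hat (ι v))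
    ; fixed     = λ v eq → trans (cong ι⁻¹ (q.fixed (ι v) (trans (sym (ι-hat v)) (cong ι eq))))
                             (ι⁻¹-ι v)
    ; edges⇔    = λ a c → mk⇔
        (λ e → let u , v , uv , ne , eq , eq′ = to (q.edges⇔ a c) e in
          ι⁻¹ u , ι⁻¹ v
          , from (p.edges⇔ _ _) (subst₂ H._~_ (sym (ι-ι⁻¹ u)) (sym (ι-ι⁻¹ v)) uv)
          , subst₂ (λ x y → q.toᵥ x ≢ q.toᵥ y) (sym (ι-ι⁻¹ u)) (sym (ι-ι⁻¹ v)) ne
          , trans (cong q.toᵥ (ι-ι⁻¹ u)) eq , trans (cong q.toᵥ (ι-ι⁻¹ v)) eq′)
        (λ (u , v , uv , rest) → from (q.edges⇔ a c) (ι u , ι v , to (p.edges⇔ u v) uv , rest))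
    ; γ-to      = λ v → trans (q.γ-to (ι v)) (sym (p.γ≡ v))
    }
    where
    module G = Graph G
    module H = Graph H
    module p = _≈_ p
    module q = _↠_ q

    ι : Fin G.order → Fin H.order
    ι = cast p.order≡

    ι⁻¹ : Fin H.order → Fin G.order
    ι⁻¹ = cast (sym p.order≡)

    ι-ι⁻¹ : ∀ v → ι (ι⁻¹ v) ≡ v
    ι-ι⁻¹ = Fin.cast-involutive p.order≡ (sym p.order≡)

    ι⁻¹-ι : ∀ v → ι⁻¹ (ι v) ≡ v
    ι⁻¹-ι = Fin.cast-involutive (sym p.order≡) p.order≡

    ι-hat : ∀ v → ι (Step.hat G v) ≡ Step.hat H (ι v)
    ι-hat v = sym (hat-unique H
      (subst₂ _≤_ (sym (Fin.toℕ-cast _ (Step.hat G v))) (sym (Fin.toℕ-cast _ v)) (Step.hat≤ G v))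
      ([ inj₁ ∘ cong ι
       , (λ (e , c) → inj₂ (to (p.edges⇔ _ _) e , trans (sym (p.γ≡ _)) (trans c (p.γ≡ _)))) ]′
        (hat-sel G v))
      λ {u} e c → subst₂ _≤_ (sym (Fin.toℕ-cast _ (Step.hat G v))) (Fin.toℕ-cast _ u)
        (hat≤neighbour G (from (p.edges⇔ _ _) (subst (ι v H.~_) (sym (ι-ι⁻¹ u)) e))
          (trans (p.γ≡ _) (trans (cong H.γ (ι-ι⁻¹ u)) (trans c (sym (p.γ≡ v)))))))

  -- Pulled back along the cast, the description of `H /β` also describes a contraction of `G`, and
  -- uniqueness identifies it with `G /β`.
  /β-cong : ∀ {G H : Graph C} → G ≈ H → G /β ≈ H /β
  /β-cong {G} {H} p = ↠-functional (↠-contract G) (≈-↠-trans p (↠-contract H))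

  ↠-connected : ∀ {G K : Graph C} → G ↠ K → Connected G → Connected K
  ↠-connected {G} {K} p conn a c =
    subst₂ (Star K._~_) (p.to-from a) (p.to-from c) (path (conn (p.fromᵥ a) (p.fromᵥ c)))
    where
    module G = Graph G
    module K = Graph K
    module p = _↠_ p

    path : ∀ {u v} → Star G._~_ u v → Star K._~_ (p.toᵥ u) (p.toᵥ v)
    path ε = ε
    path {u} {v} (_◅_ {j = w} e es) with p.toᵥ u Fin.≟ p.toᵥ w
    ... | yes eq = subst (λ x → Star K._~_ x (p.toᵥ v)) (sym eq) (path es)
    ... | no  ne = from (p.edges⇔ _ _) (u , w , e , ne , refl , refl) ◅ path es

  ↠-constant : ∀ {G K : Graph C} → G ↠ K → ConstantlyColoured G → ConstantlyColoured K
  ↠-constant {G} {K} p const a c =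
    trans (sym (colour a)) (trans (const (p.fromᵥ a) (p.fromᵥ c)) (colour c))
    where
    module p = _↠_ p

    colour : ∀ a → Graph.γ G (p.fromᵥ a) ≡ Graph.γ K a
    colour a = trans (sym (p.γ-to (p.fromᵥ a))) (cong (Graph.γ K) (p.to-from a))

  -- The Fibonacci inequality for orders.

  module _ {G K L : Graph C} (p : G ↠ K) (q : K ↠ L) (const : ConstantlyColoured G)
           (neighbour : ∀ v → ∃ λ u → Graph._~_ G v u) where
    private
      module G = Graph G
      module K = Graph K
      module L = Graph L
      module p = _↠_ p
      module q = _↠_ q

    -- A neighbour u of the least vertex of the class of a root a of K lies in that
    -- class: otherwise its class would be a smaller neighbour of a in K.
    neighbour-of-root : ∀ a → Step.hat K a ≡ a → ∀ {u} → p.fromᵥ a G.~ u → p.toᵥ u ≡ a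
    neighbour-of-root a root {u} e with p.toᵥ u Fin.≟ a
    ... | yes eq = eq
    ... | no  ne = p.from-injective (Fin.≤-antisym from-u≤ (mono⇒≤ a≤))
      where
      a~u : a K.~ p.toᵥ u
      a~u = from (p.edges⇔ _ _)
        (p.fromᵥ a , u , e , (λ eq → ne (trans (sym eq) (p.to-from a))) , p.to-from a , refl)

      a≤ : a Fin.≤ p.toᵥ u
      a≤ = subst (Fin._≤ p.toᵥ u) root (hat≤neighbour K a~u (↠-constant p const _ _))

      mono⇒≤ : ∀ {a c} → a Fin.≤ c → p.fromᵥ a Fin.≤ p.fromᵥ c
      mono⇒≤ {a} {c} a≤c = ℕ.≮⇒≥ λ lt → ℕ.≤⇒≯ a≤c (mono-cancel-< p.fromᵥ p.from-mono lt)

      from-u≤ : p.fromᵥ (p.toᵥ u) Fin.≤ p.fromᵥ a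
      -- The root of the class of `u` is at most `hat u`, which is at most `p.fromᵥ a`, a neighbour
      -- of `u`.
      from-u≤ = ℕ.≤-trans
        (subst (λ c → p.fromᵥ c Fin.≤ Step.hat G u) (p.to-hat u) (p.from-to≤ (Step.hat G u)))
        (hat≤neighbour G (G.~-sym e) (const _ _))

    nonroot : Fin L.order → Fin G.order
    nonroot c = proj₁ (neighbour (p.fromᵥ (q.fromᵥ c)))

    to-nonroot : ∀ c → p.toᵥ (nonroot c) ≡ q.fromᵥ c
    to-nonroot c = neighbour-of-root (q.fromᵥ c) (q.from-fixed c)
      (proj₂ (neighbour (p.fromᵥ (q.fromᵥ c))))

    -- The class of `nonroot c` has root `p.fromᵥ (q.fromᵥ c)`, a neighbour of `nonroot c`. If
    -- `nonroot c` were a root, it would be this one and thus adjacent to itself.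
    from≢nonroot : ∀ a c → p.fromᵥ a ≢ nonroot c
    from≢nonroot a c eq = G.~-irrefl (subst (λ v → v G.~ nonroot c) root≡nonroot
      (proj₂ (neighbour (p.fromᵥ (q.fromᵥ c)))))
      where
      root≡nonroot : p.fromᵥ (q.fromᵥ c) ≡ nonroot c
      root≡nonroot = trans
        (cong p.fromᵥ (trans (sym (to-nonroot c)) (trans (cong p.toᵥ (sym eq)) (p.to-from a)))) eq

    -- The roots and the vertices `nonroot c` embed disjointly in `G`; the latter are distinct
    -- because they lie in distinct classes.
    order+order≤ : K.order + L.order ≤ G.order
    order+order≤ = Fin.injective⇒≤ {f = place ∘ splitAt K.order} λ {i} {j} eq →
      trans (sym (Fin.join-splitAt K.order L.order i))
        (trans (cong (Fin.join K.order L.order) (place-injective (splitAt K.order i) (splitAt K.order j) eq))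
          (Fin.join-splitAt K.order L.order j))
      where
      place : Fin K.order ⊎ Fin L.order → Fin G.order
      place = [ p.fromᵥ , nonroot ]′

      place-injective : ∀ x y → place x ≡ place y → x ≡ y
      place-injective (inj₁ a) (inj₁ c) eq = cong inj₁ (p.from-injective eq)
      place-injective (inj₁ a) (inj₂ c) eq = contradiction eq (from≢nonroot a c)
      place-injective (inj₂ a) (inj₁ c) eq = contradiction (sym eq) (from≢nonroot c a)
      place-injective (inj₂ a) (inj₂ c) eq = cong inj₂ (q.from-injective
        (trans (sym (to-nonroot a)) (trans (cong p.toᵥ eq) (to-nonroot c))))

  /β-connected : ∀ (G : Graph C) → Connected G → Connected (G /β)
  /β-connected G = ↠-connected (↠-contract G)

  /β-constant : ∀ (G : Graph C) → ConstantlyColoured G → ConstantlyColoured (G /β)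
  /β-constant G = ↠-constant (↠-contract G)

  order-/β≤ : ∀ (G : Graph C) → order (G /β) ≤ order G
  order-/β≤ G = _↠_.order≤ (↠-contract G)

  order-/β+order-/β/β≤ : ∀ (G : Graph C) → Connected G → ConstantlyColoured G → order G ≢ 1 →
                         order (G /β) + order (G /β /β) ≤ order G
  order-/β+order-/β/β≤ G conn const ≢1 =
    order+order≤ (↠-contract G) (↠-contract (G /β)) const (connected⇒neighbour G conn ≢1)

  fib≤order : ∀ (H : Graph C) → Connected H → ConstantlyColoured H →
              ∀ {i} → Iterations H i → fib (2 + i) ≤ order H
  fib≤order H conn const {i} (end , not-before) = fib≤fold order _/β
    (λ G → Connected G × ConstantlyColoured G)
    (λ G (conn , const) → /β-connected G conn , /β-constant G const)
    order-/β≤ (λ G (conn , const) → order-/β+order-/β/β≤ G conn const)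
    (conn , const) end not-before i 0 refl

-- The extremal graphs: connectedness and size.

-- The vertices Fin (fib (2 + i)) = Fin (fib (1 + i) + fib i) of the extremal graph
-- split into fib (1 + i) old ones, followed by fib i new ones; the edges only join
-- old vertices to new ones. Passing from i to 1 + i makes all vertices old, adds a new
-- vertex k next to each vertex k that was old, and moves every edge between k and a
-- new c to the vertices k (now new) and c (now old).
Link : ∀ i → Fin (fib (suc i)) → Fin (fib i) → Set
Link zero    _ _ = ⊥
Link (suc i) o k = o ≡ k ↑ˡ fib i ⊎ ∃ λ c → o ≡ fib (suc i) ↑ʳ c × Link i k c

Link? : ∀ i → Decidable (Link i)
Link? zero    _ ()
Link? (suc i) o k = (o Fin.≟ k ↑ˡ fib i) ⊎-dec
                    Fin.any? λ c → (o Fin.≟ fib (suc i) ↑ʳ c) ×-dec Link? i k c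

OldNew : ∀ i → Rel (Fin (fib (2 + i))) _
OldNew i u v = ∃₂ λ o k → Link i o k × u ≡ o ↑ˡ fib i × v ≡ fib (suc i) ↑ʳ k

↑ˡ<↑ʳ : ∀ {m n} (o : Fin m) (k : Fin n) → o ↑ˡ n Fin.< m ↑ʳ k
↑ˡ<↑ʳ {m} {n} o k = subst₂ _<_ (sym (Fin.toℕ-↑ˡ o n)) (sym (Fin.toℕ-↑ʳ m k))
  (ℕ.<-≤-trans (Fin.toℕ<n o) (ℕ.m≤m+n m (toℕ k)))

OldNew⇒< : ∀ i {u v} → OldNew i u v → u Fin.< v
OldNew⇒< i (o , k , _ , refl , refl) = ↑ˡ<↑ʳ o k

OldNew? : ∀ i → Decidable (OldNew i)
OldNew? i u v = Fin.any? λ o → Fin.any? λ k →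
  Link? i o k ×-dec (u Fin.≟ o ↑ˡ fib i) ×-dec (v Fin.≟ fib (suc i) ↑ʳ k)

module _ {C : Set} (c₀ : C) where

  fibGraph : ℕ → Graph C
  fibGraph i = record
    { order    = fib (2 + i)
    ; _~_      = λ u v → OldNew i u v ⊎ OldNew i v u
    ; _~?_     = λ u v → OldNew? i u v ⊎-dec OldNew? i v u
    ; ~-sym    = swap
    ; ~-irrefl = [ ℕ.<-irrefl refl ∘ OldNew⇒< i , ℕ.<-irrefl refl ∘ OldNew⇒< i ]′
    ; γ        = λ _ → c₀
    }

  private
    module G i = Graph (fibGraph i)

  data SplitView m {n} : Fin (m + n) → Set where
    old : ∀ o → SplitView m (o ↑ˡ n)
    new : ∀ k → SplitView m (m ↑ʳ k)

  splitView : ∀ m {n} (u : Fin (m + n)) → SplitView m u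
  splitView m {n} u = subst (SplitView m) (Fin.join-splitAt m n u) (view (splitAt m u))
    where
    view : ∀ s → SplitView m (Fin.join m n s)
    view (inj₁ o) = old o
    view (inj₂ k) = new k

  stem : ∀ i k → G._~_ (suc i) (fib (2 + i) ↑ʳ k) ((k ↑ˡ fib i) ↑ˡ fib (suc i))
  stem i k = inj₂ (k ↑ˡ fib i , k , inj₁ refl , refl , refl)

  -- Every new vertex hangs on an old one by its `stem`, and old vertices are joined by lifting
  -- paths from the previous graph.
  fibGraph-connected : ∀ i → Connected (fibGraph i)
  fibGraph-connected zero    Fin.zero Fin.zero = ε
  fibGraph-connected (suc i) u v =
    toOld u ◅◅ (lift (fibGraph-connected i _ _) ◅◅ Star.reverse swap (toOld v))
    where
    parent : ∀ {u} → SplitView (fib (2 + i)) u → Fin (fib (2 + i))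
    parent (old o) = o
    parent (new k) = k ↑ˡ fib i

    toOld : ∀ u → Star (G._~_ (suc i)) u (parent (splitView _ u) ↑ˡ fib (suc i))
    toOld u with splitView (fib (2 + i)) u
    ... | old o = ε
    ... | new k = stem i k ◅ ε

    lift-edge : ∀ {u v} → OldNew i u v → Star (G._~_ (suc i)) (u ↑ˡ fib (suc i)) (v ↑ˡ fib (suc i))
    lift-edge (o , k , e , refl , refl) =
      -- The previous edge from `o` to `k` becomes a path of length two: old copy of `o`, new vertex
      -- `o`, old copy of `k`.
      swap (stem i o) ◅ inj₂ (fib (suc i) ↑ʳ k , o , inj₂ (k , refl , e) , refl , refl) ◅ ε

    lift : ∀ {u v} → Star (G._~_ i) u v → Star (G._~_ (suc i)) (u ↑ˡ fib (suc i)) (v ↑ˡ fib (suc i))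
    lift ε             = ε
    lift (inj₁ e ◅ es) = lift-edge e ◅◅ lift es
    lift (inj₂ e ◅ es) = Star.reverse swap (lift-edge e) ◅◅ lift es

  links : ∀ i → List (Fin (fib (suc i)) × Fin (fib i))
  links zero    = []
  links (suc i) = map (λ k → k ↑ˡ fib i , k) (allFin _)
               ++ map (λ (k , c) → fib (suc i) ↑ʳ c , k) (links i)

  Link⇒∈links : ∀ i {o k} → Link i o k → (o , k) ∈ links i
  Link⇒∈links (suc i) {k = k} (inj₁ refl)          = ∈-++⁺ˡ (∈-map⁺ _ (∈-allFin k))
  Link⇒∈links (suc i)         (inj₂ (c , refl , e)) = ∈-++⁺ʳ _ (∈-map⁺ _ (Link⇒∈links i e))

  -- Each stage adds `fib (suc i)` stems to the previous links, which is the Fibonacci recursion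
  -- shifted by one.
  length-links : ∀ i → suc (length (links i)) ≡ fib (2 + i)
  length-links zero    = refl
  length-links (suc i) = begin
    suc (length (links (suc i)))
      ≡⟨ cong suc (length-++ (map (λ k → k ↑ˡ fib i , k) (allFin (fib (suc i))))) ⟩
    suc (length (map (λ k → k ↑ˡ fib i , k) (allFin (fib (suc i)))) + length (map _ (links i)))
      ≡⟨ cong suc (cong₂ _+_
           (trans (length-map _ (allFin (fib (suc i)))) (length-tabulate {n = fib (suc i)} id))
           (length-map _ (links i))) ⟩
    suc (fib (suc i) + length (links i)) ≡⟨ ℕ.+-suc (fib (suc i)) _ ⟨
    fib (suc i) + suc (length (links i)) ≡⟨ cong (fib (suc i) +_) (length-links i) ⟩
    fib (suc i) + fib (2 + i)            ≡⟨ ℕ.+-comm (fib (suc i)) _ ⟩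
    fib (3 + i)                          ∎
    where open ≡-Reasoning

  -- The edge list has no repetitions and each of its pairs comes from a link, so it is no longer
  -- than `links i`.
  1+size-fibGraph≤ : ∀ i → suc (size (fibGraph i)) ≤ fib (2 + i)
  1+size-fibGraph≤ i = subst (suc (size (fibGraph i)) ≤_) (length-links i) (s≤s
    (subst (size (fibGraph i) ≤_) (length-map place (links i)) (unique⊆⇒length≤
      (Unique.filter⁺ edge? (Unique.cartesianProduct⁺ (Unique.allFin⁺ _) (Unique.allFin⁺ _)))
      λ {e} e∈ → placed e (proj₂ (∈-filter⁻ edge? {xs = cartesianProduct (allFin _) (allFin _)} e∈)))))
    where
    edge? = λ (u , v) → (u Fin.<? v) ×-dec G._~?_ i u v

    place : Fin (fib (suc i)) × Fin (fib i) → Fin (fib (2 + i)) × Fin (fib (2 + i))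
    place (o , k) = o ↑ˡ fib i , fib (suc i) ↑ʳ k

    placed : ∀ ((u , v) : Fin (fib (2 + i)) × Fin (fib (2 + i))) →
             u Fin.< v × G._~_ i u v → (u , v) ∈ map place (links i)
    placed _ (_   , inj₁ (o , k , e , refl , refl)) = ∈-map⁺ place (Link⇒∈links i e)
    placed _ (u<v , inj₂ e) = contradiction u<v (ℕ.<-asym (OldNew⇒< i e))

  -- Contraction of the extremal graphs.

  module _ (_≟_ : DecidableEquality C) where
    open Contraction _≟_

    -- Old vertices have only larger neighbours, so `hat` fixes them; it sends new `k` to old `k`.
    -- The roots are thus the old vertices, which form an initial segment and keep their numbers.
    fibGraph-↠ : ∀ i → _↠_ _≟_ (fibGraph (suc i)) (fibGraph i)
    fibGraph-↠ i = record
      { toᵥ       = toOld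
      ; fromᵥ     = _↑ˡ fib (suc i)
      ; from-mono = λ {a} {c} → subst₂ _<_ (sym (Fin.toℕ-↑ˡ a _)) (sym (Fin.toℕ-↑ˡ c _))
      ; to-from   = toOld-old
      ; to-hat    = to-hat
      ; fixed     = fixed
      ; edges⇔    = λ a c → mk⇔ (edge⇒ a c) (edge⇐ a c)
      ; γ-to      = λ _ → refl
      }
      where
      open Step (fibGraph (suc i))

      m n : ℕ
      m = fib (2 + i)
      n = fib (suc i)

      toOld : Fin (m + n) → Fin m
      toOld u = [ id , _↑ˡ fib i ]′ (splitAt m u)

      toOld-old : ∀ o → toOld (o ↑ˡ n) ≡ o
      toOld-old o = cong [ id , _↑ˡ fib i ]′ (Fin.splitAt-↑ˡ m o n)

      toOld-new : ∀ k → toOld (m ↑ʳ k) ≡ k ↑ˡ fib i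
      toOld-new k = cong [ id , _↑ˡ fib i ]′ (Fin.splitAt-↑ʳ m n k)

      hat-old : ∀ o → hat (o ↑ˡ n) ≡ o ↑ˡ n
      hat-old o = hat-unique _≟_ (fibGraph (suc i)) ℕ.≤-refl (inj₁ refl) λ
        { (inj₁ e)                       _ → ℕ.<⇒≤ (OldNew⇒< (suc i) e)
        ; (inj₂ (_ , k , _ , refl , eq)) _ → contradiction eq (Fin.<⇒≢ (↑ˡ<↑ʳ o k)) }

      -- Apart from old `k`, the neighbours of new `k` have the form `fib (suc i) ↑ʳ c` and exceed
      -- `k`.
      parent≤ : ∀ {o k} → Link (suc i) o k → k ↑ˡ fib i Fin.≤ o
      parent≤         (inj₁ refl)          = ℕ.≤-refl
      parent≤ {k = k} (inj₂ (c , refl , _)) = ℕ.<⇒≤ (↑ˡ<↑ʳ k c)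

      hat-new : ∀ k → hat (m ↑ʳ k) ≡ (k ↑ˡ fib i) ↑ˡ n
      hat-new k = hat-unique _≟_ (fibGraph (suc i)) (ℕ.<⇒≤ (↑ˡ<↑ʳ (k ↑ˡ fib i) k))
        (inj₂ (stem i k , refl)) λ
        { (inj₁ (o , _ , _ , eq , _)) _ → contradiction (sym eq) (Fin.<⇒≢ (↑ˡ<↑ʳ o k))
        ; (inj₂ (o , k′ , e , refl , eq)) _ →
            subst₂ _≤_ (sym (Fin.toℕ-↑ˡ (k ↑ˡ fib i) n)) (sym (Fin.toℕ-↑ˡ o n))
              (parent≤ (subst (Link (suc i) o) (sym (Fin.↑ʳ-injective m k k′ eq)) e)) }

      to-hat : ∀ v → toOld (hat v) ≡ toOld v
      to-hat v with splitView m v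
      ... | old o = cong toOld (hat-old o)
      ... | new k = trans (cong toOld (hat-new k)) (trans (toOld-old _) (sym (toOld-new k)))

      fixed : ∀ v → hat v ≡ v → toOld v ↑ˡ n ≡ v
      fixed v eq with splitView m v
      ... | old o = cong (_↑ˡ n) (toOld-old o)
      ... | new k = contradiction (trans (sym (hat-new k)) eq) (Fin.<⇒≢ (↑ˡ<↑ʳ (k ↑ˡ fib i) k))

      Lifted : Rel (Fin m) _
      Lifted a c = ∃₂ λ u v → G._~_ (suc i) u v × toOld u ≢ toOld v × toOld u ≡ a × toOld v ≡ c

      Lifted-sym : ∀ {a c} → Lifted a c → Lifted c a
      Lifted-sym (u , v , e , ne , eq , eq′) = v , u , swap e , ne ∘ sym , eq′ , eq

      OldNew⇒Lifted : ∀ {a c} → OldNew i a c → Lifted a c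
      OldNew⇒Lifted e@(o , k , l , refl , refl) =
        m ↑ʳ o , (fib (suc i) ↑ʳ k) ↑ˡ n
        , inj₂ (fib (suc i) ↑ʳ k , o , inj₂ (k , refl , l) , refl , refl)
        , subst₂ _≢_ (sym (toOld-new o)) (sym (toOld-old _)) (Fin.<⇒≢ (OldNew⇒< i e))
        , toOld-new o , toOld-old _

      edge⇒ : ∀ a c → G._~_ i a c → Lifted a c
      edge⇒ a c (inj₁ e) = OldNew⇒Lifted e
      edge⇒ a c (inj₂ e) = Lifted-sym (OldNew⇒Lifted e)

      -- Stems collapse, and any other edge was moved from the previous graph with the roles of old
      -- and new exchanged; hence the swapped arguments.
      project : ∀ {u v} → OldNew (suc i) u v → toOld u ≢ toOld v → OldNew i (toOld v) (toOld u)
      project (o , k , inj₁ refl , refl , refl) ne =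
        contradiction (trans (toOld-old _) (sym (toOld-new k))) ne
      project (o , k , inj₂ (c , refl , l) , refl , refl) ne =
        k , c , l , toOld-new k , toOld-old _

      edge⇐ : ∀ a c → Lifted a c → G._~_ i a c
      edge⇐ _ _ (u , v , inj₁ e , ne , refl , refl) = inj₂ (project e ne)
      edge⇐ _ _ (u , v , inj₂ e , ne , refl , refl) = inj₁ (project e (ne ∘ sym))

    fibGraph-/β : ∀ i → fibGraph (suc i) /β ≈ fibGraph i
    fibGraph-/β i = ↠-functional _≟_ (↠-contract _≟_ (fibGraph (suc i))) (fibGraph-↠ i)

    order-fibGraph-/β^ : ∀ k j → order (fibGraph (k + j) /β^ k) ≡ fib (2 + j)
    order-fibGraph-/β^ k j = _≈_.order≡
      (fold-descends _≈_ ≈-refl ≈-trans _/β (/β-cong _≟_) fibGraph fibGraph-/β k j)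

    fibGraph-iterations : ∀ i → Iterations (fibGraph i) i
    fibGraph-iterations i =
      subst (λ k → order (fibGraph k /β^ i) ≡ 1) (ℕ.+-identityʳ i) (order-fibGraph-/β^ i 0) ,
      not-before
      where
      fib>0 : ∀ d → 0 < fib (suc d)
      fib>0 zero    = s≤s z≤n
      fib>0 (suc d) = ℕ.≤-trans (fib>0 d) (ℕ.m≤m+n _ _)

      not-before : ∀ j → j < i → order (fibGraph i /β^ j) ≢ 1
      not-before j j<i eq with ℕ.m≤n⇒∃[o]m+o≡n j<i
      -- With `i` equal to `suc j + d`, the order after `j` steps is `fib (3 + d)`, a sum of two
      -- positive Fibonacci numbers.
      ... | d , refl = ℕ.<-irrefl (trans (sym eq) (trans
          (cong (λ k → order (fibGraph k /β^ j)) (sym (ℕ.+-suc j d)))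
          (order-fibGraph-/β^ j (suc d))))
        (ℕ.+-mono-≤ (fib>0 (suc d)) (fib>0 d))

mainTheorem3 : {C : Set} (_≟_ : DecidableEquality C) → C →
    let open Contraction _≟_ in
    Σ[ G ∈ (ℕ → Graph C) ]
    (∀ i → Connected (G i) × ConstantlyColoured (G i))
    × (order (G 0) ≡ 1 × Edgeless (G 0))
    × (∀ i →
    Iterations (G i) i
    × (∀ (H : Graph C) → Connected H → ConstantlyColoured H → Iterations H i →
    order (G i) ≤ order H × size (G i) ≤ size H)
    × (order (G i) ≡ fib (i + 2) × G (suc i) /β ≈ G i))
mainTheorem3 _≟_ c₀ =
  fibGraph c₀
  , (λ i → fibGraph-connected c₀ i , λ _ _ → refl)
  , (refl , λ u v → λ { (inj₁ ()) ; (inj₂ ()) })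
  , λ i →
    fibGraph-iterations c₀ _≟_ i
    , (λ H conn const it →
        let n≤ = fib≤order _≟_ H conn const it in
        -- The chain is `suc (size (G i)) ≤ fib (2 + i) ≤ order H ≤ suc (size H)`.
        n≤ , ℕ.≤-pred (ℕ.≤-trans (1+size-fibGraph≤ c₀ i)
                        (ℕ.≤-trans n≤ (connected⇒order≤1+size H conn))))
    , (cong fib (ℕ.+-comm 2 i) , fibGraph-/β c₀ _≟_ i)
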